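{- Let $\widehat{\mathit{Eng}}$ be the same as the engine $\mathit{Eng}$ defined in the context, except for the evolution map, in which $\mathit{heat}(\xi_u^i,\mathit{cool})=-0.7$ if $\xi_u^i(\mathit{cool})=\mathsf{on}$. Then $\mathit{Eng} \not\approx \widehat{\mathit{Eng}}$.
   Context: **Names and values.** There are sets of state variables $\mathcal{X}$, channels $\mathcal{C}$, actuators $\mathcal{A}$ and sensors $\mathcal{S}$. Values $v$ are built from basic values (Booleans, integers, real numbers) and also include names. For a set of names $\mathcal{N}$, $\mathbb{R}^{\mathcal{N}}$ is the set of functions $\mathcal{N}\to\mathbb{R}$, ordered pointwise; $\xi[n\mapsto v]$ is $\xi$ updated at $n$ to $v$. **Physical environment.** Given $\hat{\mathcal{X}}\subseteq\mathcal{X}$, $\hat{\mathcal{A}}\subseteq\mathcal{A}$, $\hat{\mathcal{S}}\subseteq\mathcal{S}$, a physical environment is a 7-tuple $E=\langle \xi_x,\xi_u,\xi_w,\mathit{evol},\xi_e,\mathit{meas},\mathit{inv}\rangle$ of total functions: state function $\xi_x\in\mathbb{R}^{\hat{\mathcal{X}}}$, actuator function $\xi_u\in\mathbb{R}^{\hat{\mathcal{A}}}$, uncertainty function $\xi_w\in\mathbb{R}^{\hat{\mathcal{X}}}$, evolution map $\mathit{evol}:\mathbb{R}^{\hat{\mathcal{X}}}\times\mathbb{R}^{\hat{\mathcal{A}}}\times\mathbb{R}^{\hat{\mathcal{X}}}\to 2^{\mathbb{R}^{\hat{\mathcal{X}}}}$, sensor-error function $\xi_e\in\mathbb{R}^{\hat{\mathcal{S}}}$,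 measurement map $\mathit{meas}:\mathbb{R}^{\hat{\mathcal{X}}}\times\mathbb{R}^{\hat{\mathcal{S}}}\to 2^{\mathbb{R}^{\hat{\mathcal{S}}}}$, invariant function $\mathit{inv}:\mathbb{R}^{\hat{\mathcal{X}}}\to\{\mathsf{true},\mathsf{false}\}$. Operators: $\mathit{read\_sensor}(E,s)=\{\xi(s):\xi\in\mathit{meas}(\xi_x,\xi_e)\}$; $\mathit{update\_act}(E,a,v)$ is $E$ with $\xi_u$ replaced by $\xi_u[a\mapsto v]$; $\mathit{next}(E)$ is the set of environments obtained from $E$ by replacing $\xi_x$ with some $\xi\in\mathit{evol}(\xi_x,\xi_u,\xi_w)$; $\mathit{inv}(E)=\mathit{inv}(\xi_x)$. **Processes.** $P,Q ::= \mathsf{nil} \mid \mathsf{tick}.P \mid P\parallel Q \mid \lfloor\pi.P\rfloor Q \mid \mathsf{if}\,(b)\,\{P\}\,\mathsf{else}\,\{Q\} \mid P\setminus c \mid X \mid \mathsf{fix}\,X.P$, with prefixes $\pi$ among: $\overline{c}\langle v\rangle$ (send $v$ on channel $c$), $c(x)$ (receive on $c$), $\mathsf{read}\,s(x)$ (read sensor $s$), $\mathsf{write}\,a\langle v\rangle$ (write $v$ on actuator $a$). The variable $x$ is bound in $\lfloor c(x).P\rfloor Q$ and $\lfloor\mathsf{read}\,s(x).P\rfloor Q$ (with scope $P$), and $X$ is bound in $\mathsf{fix}\,X.P$; processes are taken up to $\alpha$-conversion and are closed (no free variables or process variables). In $\mathsf{tick}.Q$ and $\lfloor\pi.P\rfloor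 Q$ the occurrence of $Q$ is time-guarded; in $\mathsf{fix}\,X.P$ all occurrences of $X$ in $P$ must be time-guarded. Guards $b$ are decidable, and $\mathsf{if}\,(b)\,\{P\}\,\mathsf{else}\,\{Q\}$ is identified with $P$ if $b$ is true and with $Q$ if $b$ is false. $T\{v/x\}$ and $T\{P/X\}$ denote substitution. Abbreviations: $\pi.P$ stands for $\mathsf{fix}\,X.\lfloor\pi.P\rfloor X$ with $X$ not in $P$; $\mathsf{tick}^k.P$ is $k$ consecutive $\mathsf{tick}$ prefixes followed by $P$. **Process transitions** $P\xrightarrow{\lambda}P'$, $\lambda\in\{\mathsf{tick},\tau,\overline{c}v,cv,a!v,s?v\}$, are the least relation such that: $\lfloor\overline{c}\langle v\rangle.P\rfloor Q\xrightarrow{\overline{c}v}P$; $\lfloor c(x).P\rfloor Q\xrightarrow{cv}P\{v/x\}$; $\lfloor\mathsf{write}\,a\langle v\rangle.P\rfloor Q\xrightarrow{a!v}P$; $\lfloor\mathsf{read}\,s(x).P\rfloor Q\xrightarrow{s?v}P\{v/x\}$; if $P\xrightarrow{\overline{c}v}P'$ and $Q\xrightarrow{cv}Q'$ then $P\parallel Q\xrightarrow{\tau}P'\parallel Q'$ (and symmetrically); if $P\xrightarrow{\lambda}P'$ and $\lambda\ne\mathsf{tick}$ then $P\parallel Q\xrightarrow{\lambda}P'\parallel Q$ (and symmetrically); if $P\xrightarrow{\lambda}P'$ and $\lambda\notin\{cv,\overline{c}v\}$ then $P\setminus c\xrightarrow{\lambda}P'\setminus c$; if $P\{\mathsf{fix}\,X.P/X\}\xrightarrow{\lambda}Q$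 then $\mathsf{fix}\,X.P\xrightarrow{\lambda}Q$; $\mathsf{nil}\xrightarrow{\mathsf{tick}}\mathsf{nil}$; $\mathsf{tick}.P\xrightarrow{\mathsf{tick}}P$; $\lfloor\pi.P\rfloor Q\xrightarrow{\mathsf{tick}}Q$; if $P\xrightarrow{\mathsf{tick}}P'$, $Q\xrightarrow{\mathsf{tick}}Q'$ and $P\parallel Q$ has no $\tau$-transition then $P\parallel Q\xrightarrow{\mathsf{tick}}P'\parallel Q'$. **CPSs.** A CPS is $M=E\Join P$, always assumed well-formed: every sensor $s$ mentioned in $P$ is in the domain of $\xi_e$ and every actuator $a$ mentioned in $P$ is in the domain of $\xi_u$. Transitions $M\xrightarrow{\alpha}M'$, $\alpha\in\{\tau,\overline{c}v,cv,\mathsf{tick}\}$, all requiring $\mathit{inv}(E)=\mathsf{true}$: - $E\Join P\xrightarrow{\overline{c}v}E\Join P'$ if $P\xrightarrow{\overline{c}v}P'$; $E\Join P\xrightarrow{cv}E\Join P'$ if $P\xrightarrow{cv}P'$; - (SensRead) $E\Join P\xrightarrow{\tau}E\Join P'$ if $P\xrightarrow{s?v}P'$ and $v\in\mathit{read\_sensor}(E,s)$; - (ActWrite) $E\Join P\xrightarrow{\tau}\mathit{update\_act}(E,a,v)\Join P'$ if $P\xrightarrow{a!v}P'$; - (Tau) $E\Join P\xrightarrow{\tau}E\Join P'$ if $P\xrightarrow{\tau}P'$; - (Time) $E\Join P\xrightarrow{\mathsf{tick}}E'\Join P'$ if $P\xrightarrow{\mathsf{tick}}P'$, $E\Join P$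 has no $\tau$-transition, and $E'\in\mathit{next}(E)$. **Bisimilarity.** $\Rightarrow$ is the reflexive-transitive closure of $\xrightarrow{\tau}$; $\stackrel{\alpha}{\Rightarrow}$ is $\Rightarrow\xrightarrow{\alpha}\Rightarrow$; $\stackrel{\hat\alpha}{\Rightarrow}$ is $\Rightarrow$ if $\alpha=\tau$ and $\stackrel{\alpha}{\Rightarrow}$ otherwise. A symmetric relation $\mathcal{R}$ on CPSs is a bisimulation if $M\,\mathcal{R}\,N$ and $M\xrightarrow{\alpha}M'$ imply that there is $N'$ with $N\stackrel{\hat\alpha}{\Rightarrow}N'$ and $M'\,\mathcal{R}\,N'$. $M\approx N$ iff $M\,\mathcal{R}\,N$ for some bisimulation $\mathcal{R}$. **The engine.** $\mathit{Env}=\langle \xi_x,\xi_u,\xi_w,\mathit{evol},\xi_e,\mathit{meas},\mathit{inv}\rangle$ has one state variable $\mathit{temp}$, one actuator $\mathit{cool}$, one sensor $s_t$, and: $\xi_x(\mathit{temp})=0$; $\xi_u(\mathit{cool})=\mathsf{off}$ (actuator values are regarded as elements of $\{\mathsf{on},\mathsf{off}\}$, a real value $\ge0$ standing for $\mathsf{off}$ and $<0$ for $\mathsf{on}$); $\xi_w(\mathit{temp})=\delta=0.4$; $\mathit{evol}(\xi_x^i,\xi_u^i,\xi_w)=\{\xi:\xi(\mathit{temp})=\xi_x^i(\mathit{temp})+\mathit{heat}(\xi_u^i,\mathit{cool})+\gamma,\ \gamma\in[-\delta,+\delta]\}$, where $\mathit{heat}(\xi_u^i,\mathit{cool})=-1$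 if $\xi_u^i(\mathit{cool})=\mathsf{on}$ and $+1$ if $\xi_u^i(\mathit{cool})=\mathsf{off}$; $\xi_e(s_t)=\epsilon=0.1$; $\mathit{meas}(\xi_x^i,\xi_e)=\{\xi:\xi(s_t)\in[\xi_x^i(\mathit{temp})-\epsilon,\xi_x^i(\mathit{temp})+\epsilon]\}$; $\mathit{inv}(\xi_x)=\mathsf{true}$ iff $0\le\xi_x(\mathit{temp})\le30$. The controller is $$\mathit{Ctrl}=\mathsf{fix}\,X.\,\mathsf{read}\,s_t(x).\,\mathsf{if}\,(x>10)\,\{\mathit{Cooling}\}\,\mathsf{else}\,\{\mathsf{tick}.X\},$$ $$\mathit{Cooling}=\mathsf{write}\,\mathit{cool}\langle\mathsf{on}\rangle.\,\mathsf{fix}\,Y.\,\mathsf{tick}^5.\,\mathsf{read}\,s_t(x).\,\mathsf{if}\,(x>10)\,\{\overline{\mathit{warning}}\langle\mathrm{ID}\rangle.Y\}\,\mathsf{else}\,\{\mathsf{write}\,\mathit{cool}\langle\mathsf{off}\rangle.\mathsf{tick}.X\},$$ where $\mathit{warning}$ is a channel and $\mathrm{ID}$ a value (the engine identifier). $\mathit{Eng}=\mathit{Env}\Join\mathit{Ctrl}$. -}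

module Defs where

open import Algebra.Structures using (IsCommutativeRing)
open import Data.Bool.Base using (Bool; true; false; not; if_then_else_; _∧_)
open import Data.Fin.Base using (Fin; zero; suc)
open import Data.Integer.Base using (ℤ)
open import Data.Nat.Base as ℕ using (ℕ; zero; suc)
open import Data.Product.Base using (Σ-syntax; ∃; ∃-syntax; ∃₂; _×_; _,_)
open import Data.Unit.Base using (⊤)
open import Data.Vec.Functional using (Vector)
open import Level using (0ℓ) renaming (suc to lsuc)
open import Relation.Binary.Construct.Closure.ReflexiveTransitive using (Star)
open import Relation.Binary.Core using (Rel)
open import Relation.Binary.Definitions using (DecidableEquality; Symmetric)
open import Relation.Binary.PropositionalEquality.Core using (_≡_; _≢_; refl)
open import Relation.Binary.Structures using (IsDecTotalOrder)
open import Relation.Nullary.Decidable.Core using (⌊_⌋)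
open import Relation.Nullary.Negation.Core using (¬_)
open import Relation.Unary using (Pred; _∈_; ｛_｝; Satisfiable)

-- The standard library has no real numbers; ℝ is given by the axioms that
-- characterise it classically up to unique isomorphism, as the
-- Dedekind-complete ordered field.  As usual, 0# ⁻¹ is left unspecified.

record RealNumbers : Set₁ where
  infixl 6 _+_
  infixl 7 _*_
  infix  8 -_
  infix  9 _⁻¹
  infix  4 _≤_
  field
    ℝ       : Set
    _+_ _*_ : ℝ → ℝ → ℝ
    -_ _⁻¹  : ℝ → ℝ
    0# 1#   : ℝ
    _≤_     : Rel ℝ 0ℓ
    isCommutativeRing : IsCommutativeRing _≡_ _+_ _*_ -_ 0# 1#
    isDecTotalOrder   : IsDecTotalOrder _≡_ _≤_
    0≢1               : 0# ≢ 1#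
    ⁻¹-inverseʳ       : ∀ x → x ≢ 0# → x * x ⁻¹ ≡ 1#
    +-monoˡ-≤         : ∀ z {x y} → x ≤ y → x + z ≤ y + z
    *-nonNegative     : ∀ {x y} → 0# ≤ x → 0# ≤ y → 0# ≤ x * y

  UpperBound : Pred ℝ 0ℓ → Pred ℝ 0ℓ
  UpperBound S b = ∀ x → x ∈ S → x ≤ b

  field
    complete : ∀ S → Satisfiable S → Satisfiable (UpperBound S) →
               ∃[ s ] s ∈ UpperBound S × (∀ b → b ∈ UpperBound S → s ≤ b)

  open IsDecTotalOrder isDecTotalOrder public using (_≤?_)

  fromℕ : ℕ → ℝ
  fromℕ zero    = 0#
  fromℕ (suc n) = 1# + fromℕ n

  tenths : ℕ → ℝ
  tenths n = fromℕ n * fromℕ 10 ⁻¹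

record Names : Set₁ where
  field
    𝒳 𝒞 𝒜 𝒮 : Set
    _≟_ : DecidableEquality 𝒜

module Calculus (reals : RealNumbers) (names : Names) where

  open RealNumbers reals
  open Names names

  data Name : Set where
    stateVar : 𝒳 → Name
    channel  : 𝒞 → Name
    actuator : 𝒜 → Name
    sensor   : 𝒮 → Name

  data Value : Set where
    bool : Bool → Value
    int  : ℤ → Value
    real : ℝ → Value
    name : Name → Value

  -- ℝ^ N̂ is the function space N̂ → ℝ for a subset N̂ of N; irrelevance of the
  -- membership proof makes the value depend on the name alone.

  infix 8 ℝ^_
  ℝ^_ : {N : Set} → Pred N 0ℓ → Set
  ℝ^ N̂ = ∀ n → .(n ∈ N̂) → ℝ

  record Env : Set₁ where
    field
      X̂ : Pred 𝒳 0ℓ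
      Â : Pred 𝒜 0ℓ
      Ŝ : Pred 𝒮 0ℓ
      ξx   : ℝ^ X̂
      ξu   : ℝ^ Â
      ξw   : ℝ^ X̂
      evol : ℝ^ X̂ → ℝ^ Â → ℝ^ X̂ → Pred (ℝ^ X̂) 0ℓ
      ξe   : ℝ^ Ŝ
      meas : ℝ^ X̂ → ℝ^ Ŝ → Pred (ℝ^ Ŝ) 0ℓ
      inv  : ℝ^ X̂ → Bool

  _[_↦_] : {Â : Pred 𝒜 0ℓ} → ℝ^ Â → 𝒜 → ℝ → ℝ^ Â
  (ξ [ a ↦ v ]) b b∈Â = if ⌊ b ≟ a ⌋ then v else ξ b b∈Â

  readSensor : Env → 𝒮 → Pred ℝ 0ℓ
  readSensor E s v = Σ[ s∈Ŝ ∈ s ∈ Ŝ ] ∃[ ξ ] ξ ∈ meas ξx ξe × v ≡ ξ s s∈Ŝ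
    where open Env E

  updateAct : Env → 𝒜 → ℝ → Env
  updateAct E a v = record E { ξu = Env.ξu E [ a ↦ v ] }

  next : Env → Pred Env (lsuc 0ℓ)
  next E E′ = ∃[ ξ ] ξ ∈ evol ξx ξu ξw × E′ ≡ record E { ξx = ξ }
    where open Env E

  invariant : Env → Bool
  invariant E = Env.inv E (Env.ξx E)

  -- Proc n k has n free variables and k free process variables, both as
  -- de Bruijn indices, so that α-equivalent processes are equal.

  data Term (n : ℕ) : Set where
    var : Fin n → Term n
    val : Value → Term n

  Guard : ℕ → Set
  Guard n = Vector Value n → Bool

  -- The second index is the number of variables bound by the prefix.

  data Prefix (n : ℕ) : ℕ → Set where
    send  : 𝒞 → Term n → Prefix n 0
    recv  : 𝒞 → Prefix n 1
    read  : 𝒮 → Prefix n 1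
    write : 𝒜 → Term n → Prefix n 0

  infixr 6 _∥_
  infixl 7 _∖_

  data Proc (n k : ℕ) : Set where
    nil   : Proc n k
    tick∙ : Proc n k → Proc n k
    _∥_   : Proc n k → Proc n k → Proc n k
    ⌊_·_⌋ : ∀ {b} → Prefix n b → Proc (b ℕ.+ n) k → Proc n k → Proc n k
    ifte  : Guard n → Proc n k → Proc n k → Proc n k
    _∖_   : Proc n k → 𝒞 → Proc n k
    pvar  : Fin k → Proc n k
    fix   : Proc n (suc k) → Proc n k

  Subst : ℕ → ℕ → Set
  Subst n m = Fin n → Term m

  shift : ∀ {n} → Term n → Term (suc n)
  shift (var i) = var (suc i)
  shift (val v) = val v

  lift : ∀ {n m} b → Subst n m → Subst (b ℕ.+ n) (b ℕ.+ m)
  lift zero    σ i       = σ i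
  lift (suc b) σ zero    = var zero
  lift (suc b) σ (suc i) = shift (lift b σ i)

  substTerm : ∀ {n m} → Subst n m → Term n → Term m
  substTerm σ (var i) = σ i
  substTerm σ (val v) = val v

  substPrefix : ∀ {n m b} → Subst n m → Prefix n b → Prefix m b
  substPrefix σ (send c e)  = send c (substTerm σ e)
  substPrefix σ (recv c)    = recv c
  substPrefix σ (read s)    = read s
  substPrefix σ (write a e) = write a (substTerm σ e)

  eval : ∀ {n} → Vector Value n → Term n → Value
  eval ρ (var i) = ρ i
  eval ρ (val v) = v

  substGuard : ∀ {n m} → Subst n m → Guard n → Guard m
  substGuard σ g ρ = g (λ i → eval ρ (σ i))

  subst : ∀ {n m k} → Subst n m → Proc n k → Proc m k
  subst σ nil               = nil
  subst σ (tick∙ P)         = tick∙ (subst σ P)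
  subst σ (P ∥ Q)           = subst σ P ∥ subst σ Q
  subst σ (⌊_·_⌋ {b} π P Q) = ⌊ substPrefix σ π · subst (lift b σ) P ⌋ (subst σ Q)
  subst σ (ifte g P Q)      = ifte (substGuard σ g) (subst σ P) (subst σ Q)
  subst σ (P ∖ c)           = subst σ P ∖ c
  subst σ (pvar X)          = pvar X
  subst σ (fix P)           = fix (subst σ P)

  weakenVars : ∀ {n k} b → Proc n k → Proc (b ℕ.+ n) k
  weakenVars zero    P = P
  weakenVars (suc b) P = subst (λ i → var (suc i)) (weakenVars b P)

  liftRen : ∀ {k l} → (Fin k → Fin l) → Fin (suc k) → Fin (suc l)
  liftRen r zero    = zero
  liftRen r (suc X) = suc (r X)

  renameProc : ∀ {n k l} → (Fin k → Fin l) → Proc n k → Proc n l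
  renameProc r nil           = nil
  renameProc r (tick∙ P)     = tick∙ (renameProc r P)
  renameProc r (P ∥ Q)       = renameProc r P ∥ renameProc r Q
  renameProc r (⌊ π · P ⌋ Q) = ⌊ π · renameProc r P ⌋ (renameProc r Q)
  renameProc r (ifte g P Q)  = ifte g (renameProc r P) (renameProc r Q)
  renameProc r (P ∖ c)       = renameProc r P ∖ c
  renameProc r (pvar X)      = pvar (r X)
  renameProc r (fix P)       = fix (renameProc (liftRen r) P)

  PSubst : ℕ → ℕ → ℕ → Set
  PSubst n k l = Fin k → Proc n l

  liftP : ∀ {n k l} → PSubst n k l → PSubst n (suc k) (suc l)
  liftP σ zero    = pvar zero
  liftP σ (suc X) = renameProc suc (σ X)

  substProc : ∀ {n k l} → PSubst n k l → Proc n k → Proc n l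
  substProc σ nil               = nil
  substProc σ (tick∙ P)         = tick∙ (substProc σ P)
  substProc σ (P ∥ Q)           = substProc σ P ∥ substProc σ Q
  substProc σ (⌊_·_⌋ {b} π P Q) =
    ⌊ π · substProc (λ X → weakenVars b (σ X)) P ⌋ (substProc σ Q)
  substProc σ (ifte g P Q)      = ifte g (substProc σ P) (substProc σ Q)
  substProc σ (P ∖ c)           = substProc σ P ∖ c
  substProc σ (pvar X)          = σ X
  substProc σ (fix P)           = fix (substProc (liftP σ) P)

  infix 9 _⟨_/x⟩ _⟨_/X⟩

  _⟨_/x⟩ : Proc 1 0 → Value → Proc 0 0
  P ⟨ v /x⟩ = subst (λ _ → val v) P

  _⟨_/X⟩ : Proc 0 1 → Proc 0 0 → Proc 0 0
  P ⟨ Q /X⟩ = substProc (λ _ → Q) P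

  infixr 5 _∙_

  _∙_ : ∀ {n k b} → Prefix n b → Proc (b ℕ.+ n) k → Proc n k
  π ∙ P = fix (⌊ π · renameProc suc P ⌋ (pvar zero))

  tick^ : ∀ {n k} → ℕ → Proc n k → Proc n k
  tick^ zero    P = P
  tick^ (suc j) P = tick∙ (tick^ j P)

  -- Every occurrence of X in the process is time-guarded.

  TimeGuarded : ∀ {n k} → Fin k → Proc n k → Set
  TimeGuarded X nil           = ⊤
  TimeGuarded X (tick∙ P)     = ⊤
  TimeGuarded X (P ∥ Q)       = TimeGuarded X P × TimeGuarded X Q
  TimeGuarded X (⌊ π · P ⌋ Q) = TimeGuarded X P
  TimeGuarded X (ifte g P Q)  = TimeGuarded X P × TimeGuarded X Q
  TimeGuarded X (P ∖ c)       = TimeGuarded X P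
  TimeGuarded X (pvar Y)      = Y ≢ X
  TimeGuarded X (fix P)       = TimeGuarded (suc X) P

  PrefixOver : ∀ {n b} → Pred 𝒜 0ℓ → Pred 𝒮 0ℓ → Prefix n b → Set
  PrefixOver Â Ŝ (send c e)  = ⊤
  PrefixOver Â Ŝ (recv c)    = ⊤
  PrefixOver Â Ŝ (read s)    = s ∈ Ŝ
  PrefixOver Â Ŝ (write a e) = a ∈ Â

  WellFormedProc : ∀ {n k} → Pred 𝒜 0ℓ → Pred 𝒮 0ℓ → Proc n k → Set
  WellFormedProc Â Ŝ nil           = ⊤
  WellFormedProc Â Ŝ (tick∙ P)     = WellFormedProc Â Ŝ P
  WellFormedProc Â Ŝ (P ∥ Q)       = WellFormedProc Â Ŝ P × WellFormedProc Â Ŝ Q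
  WellFormedProc Â Ŝ (⌊ π · P ⌋ Q) =
    PrefixOver Â Ŝ π × WellFormedProc Â Ŝ P × WellFormedProc Â Ŝ Q
  WellFormedProc Â Ŝ (ifte g P Q)  = WellFormedProc Â Ŝ P × WellFormedProc Â Ŝ Q
  WellFormedProc Â Ŝ (P ∖ c)       = WellFormedProc Â Ŝ P
  WellFormedProc Â Ŝ (pvar X)      = ⊤
  WellFormedProc Â Ŝ (fix P)       = TimeGuarded zero P × WellFormedProc Â Ŝ P

  data Action : Set where
    τ   : Action
    out : 𝒞 → Value → Action
    inp : 𝒞 → Value → Action
    wrt : 𝒜 → Value → Action
    rd  : 𝒮 → Value → Action

  _Avoids_ : Action → 𝒞 → Set
  out d v Avoids c = d ≢ c
  inp d v Avoids c = d ≢ c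
  τ       Avoids c = ⊤
  wrt a v Avoids c = ⊤
  rd s v  Avoids c = ⊤

  -- The transition relation of processes is stratified: no rule for an action
  -- other than tick has a tick premise, and the negative premise of the tick
  -- rule for parallel composition concerns τ only.  The rules if-true and
  -- if-false realise the identification of a conditional with one branch.

  infix 3 _⟶⟨_⟩_ _⟶tick_

  data _⟶⟨_⟩_ : Proc 0 0 → Action → Proc 0 0 → Set where
    outp  : ∀ {c v P Q} → ⌊ send c (val v) · P ⌋ Q ⟶⟨ out c v ⟩ P
    inpp  : ∀ {c v P Q} → ⌊ recv c · P ⌋ Q ⟶⟨ inp c v ⟩ P ⟨ v /x⟩
    write : ∀ {a v P Q} → ⌊ write a (val v) · P ⌋ Q ⟶⟨ wrt a v ⟩ P
    read  : ∀ {s v P Q} → ⌊ read s · P ⌋ Q ⟶⟨ rd s v ⟩ P ⟨ v /x⟩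
    comˡ  : ∀ {c v P P′ Q Q′} → P ⟶⟨ out c v ⟩ P′ → Q ⟶⟨ inp c v ⟩ Q′ →
            P ∥ Q ⟶⟨ τ ⟩ P′ ∥ Q′
    comʳ  : ∀ {c v P P′ Q Q′} → P ⟶⟨ inp c v ⟩ P′ → Q ⟶⟨ out c v ⟩ Q′ →
            P ∥ Q ⟶⟨ τ ⟩ P′ ∥ Q′
    parˡ  : ∀ {l P P′ Q} → P ⟶⟨ l ⟩ P′ → P ∥ Q ⟶⟨ l ⟩ P′ ∥ Q
    parʳ  : ∀ {l P Q Q′} → Q ⟶⟨ l ⟩ Q′ → P ∥ Q ⟶⟨ l ⟩ P ∥ Q′
    res   : ∀ {l c P P′} → P ⟶⟨ l ⟩ P′ → l Avoids c → P ∖ c ⟶⟨ l ⟩ P′ ∖ c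
    rec   : ∀ {l P Q} → P ⟨ fix P /X⟩ ⟶⟨ l ⟩ Q → fix P ⟶⟨ l ⟩ Q
    if-true  : ∀ {l g P Q R} → g (λ ()) ≡ true  → P ⟶⟨ l ⟩ R → ifte g P Q ⟶⟨ l ⟩ R
    if-false : ∀ {l g P Q R} → g (λ ()) ≡ false → Q ⟶⟨ l ⟩ R → ifte g P Q ⟶⟨ l ⟩ R

  data _⟶tick_ : Proc 0 0 → Proc 0 0 → Set where
    timeNil : nil ⟶tick nil
    delay   : ∀ {P} → tick∙ P ⟶tick P
    timeout : ∀ {b} {π : Prefix 0 b} {P Q} → ⌊ π · P ⌋ Q ⟶tick Q
    timePar : ∀ {P P′ Q Q′} → P ⟶tick P′ → Q ⟶tick Q′ →
              ¬ (∃[ R ] (P ∥ Q ⟶⟨ τ ⟩ R)) → P ∥ Q ⟶tick P′ ∥ Q′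
    res     : ∀ {c P P′} → P ⟶tick P′ → P ∖ c ⟶tick P′ ∖ c
    rec     : ∀ {P Q} → P ⟨ fix P /X⟩ ⟶tick Q → fix P ⟶tick Q
    if-true  : ∀ {g P Q R} → g (λ ()) ≡ true  → P ⟶tick R → ifte g P Q ⟶tick R
    if-false : ∀ {g P Q R} → g (λ ()) ≡ false → Q ⟶tick R → ifte g P Q ⟶tick R

  infix 5 _⋈_

  record CPS : Set₁ where
    constructor _⋈_
    field
      env  : Env
      proc : Proc 0 0

  WellFormed : Pred CPS 0ℓ
  WellFormed (E ⋈ P) = WellFormedProc (Env.Â E) (Env.Ŝ E) P

  data Label : Set where
    tick τ  : Label
    out inp : 𝒞 → Value → Label

  infix 3 _—τ→_ _—[_]→_ _⇒_ _⇒[_]_ _⇒̂[_]_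

  data _—τ→_ : CPS → CPS → Set₁ where
    sensRead : ∀ {E P P′ s v} → invariant E ≡ true →
               P ⟶⟨ rd s (real v) ⟩ P′ → v ∈ readSensor E s →
               E ⋈ P —τ→ E ⋈ P′
    actWrite : ∀ {E P P′ a v} → invariant E ≡ true →
               P ⟶⟨ wrt a (real v) ⟩ P′ →
               E ⋈ P —τ→ updateAct E a v ⋈ P′
    tau      : ∀ {E P P′} → invariant E ≡ true → P ⟶⟨ τ ⟩ P′ → E ⋈ P —τ→ E ⋈ P′

  data _—[_]→_ : CPS → Label → CPS → Set₁ where
    out  : ∀ {E P P′ c v} → invariant E ≡ true → P ⟶⟨ out c v ⟩ P′ →
           E ⋈ P —[ out c v ]→ E ⋈ P′
    inp  : ∀ {E P P′ c v} → invariant E ≡ true → P ⟶⟨ inp c v ⟩ P′ →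
           E ⋈ P —[ inp c v ]→ E ⋈ P′
    τ    : ∀ {M M′} → M —τ→ M′ → M —[ τ ]→ M′
    time : ∀ {E E′ P P′} → invariant E ≡ true → P ⟶tick P′ →
           ¬ (∃[ N ] (E ⋈ P —τ→ N)) → E′ ∈ next E →
           E ⋈ P —[ tick ]→ E′ ⋈ P′

  _⇒_ : CPS → CPS → Set₁
  _⇒_ = Star _—τ→_

  _⇒[_]_ : CPS → Label → CPS → Set₁
  M ⇒[ α ] N = ∃₂ λ M′ N′ → (M ⇒ M′) × (M′ —[ α ]→ N′) × (N′ ⇒ N)

  _⇒̂[_]_ : CPS → Label → CPS → Set₁
  M ⇒̂[ τ ]       N = M ⇒ N
  M ⇒̂[ tick ]    N = M ⇒[ tick ] N
  M ⇒̂[ out c v ] N = M ⇒[ out c v ] N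
  M ⇒̂[ inp c v ] N = M ⇒[ inp c v ] N

  -- CPSs are assumed well-formed, so a bisimulation relates only such;
  -- by symmetry wellFormed applies to both sides.

  record IsBisimulation (R : Rel CPS (lsuc 0ℓ)) : Set₁ where
    field
      wellFormed : ∀ {M N} → R M N → WellFormed M
      symmetric  : Symmetric R
      transfer   : ∀ {M N α M′} → R M N → M —[ α ]→ M′ →
                   ∃[ N′ ] (N ⇒̂[ α ] N′) × R M′ N′

  infix 4 _≈_
  _≈_ : CPS → CPS → Set₂
  M ≈ N = ∃[ R ] IsBisimulation R × R M N

-- Any real encodings of the two actuator positions are allowed, as long as
-- off is nonnegative and on is negative.

record EngineSetting (reals : RealNumbers) (names : Names) : Set where
  open RealNumbers reals
  open Names names
  open Calculus reals names using (Value)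
  field
    temp    : 𝒳
    cool    : 𝒜
    sₜ      : 𝒮
    warning : 𝒞
    ID      : Value
    on off  : ℝ
    on<0    : ¬ (0# ≤ on)
    off≥0   : 0# ≤ off

module Engine (reals : RealNumbers) (names : Names)
              (setting : EngineSetting reals names) where

  open RealNumbers reals
  open Calculus reals names
  open EngineSetting setting

  δ ε : ℝ
  δ = tenths 4
  ε = tenths 1

  -- heatOn is the temperature variation per time unit when cooling is on.

  heat : (heatOn : ℝ) → ℝ^ ｛ cool ｝ → ℝ
  heat heatOn ξu = if ⌊ 0# ≤? ξu cool refl ⌋ then 1# else heatOn

  engineEnv : (heatOn : ℝ) → Env
  engineEnv heatOn = record
    { X̂    = ｛ temp ｝
    ; Â    = ｛ cool ｝
    ; Ŝ    = ｛ sₜ ｝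
    ; ξx   = λ _ _ → 0#
    ; ξu   = λ _ _ → off
    ; ξw   = λ _ _ → δ
    ; evol = λ ξx ξu ξw ξ → ∃[ γ ] - δ ≤ γ × γ ≤ δ ×
               ξ temp refl ≡ ξx temp refl + heat heatOn ξu + γ
    ; ξe   = λ _ _ → ε
    ; meas = λ ξx ξe ξ → ξx temp refl + - ε ≤ ξ sₜ refl ×
                         ξ sₜ refl ≤ ξx temp refl + ε
    ; inv  = λ ξx → ⌊ 0# ≤? ξx temp refl ⌋ ∧ ⌊ ξx temp refl ≤? fromℕ 30 ⌋
    }

  -- The guard x > 10 on the most recently bound variable x, which is always a
  -- sensor reading; on other values its choice is immaterial.

  above10 : Value → Bool
  above10 (real r) = not ⌊ r ≤? fromℕ 10 ⌋
  above10 _        = false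

  x>10 : ∀ {n} → Guard (suc n)
  x>10 ρ = above10 (ρ zero)

  -- In Cooling the process variable 0 is the X of Ctrl; under the inner fix
  -- 0 is Y and 1 is X.

  Cooling : Proc 1 1
  Cooling =
    write cool (val (real on)) ∙
    fix (tick^ 5 (read sₜ ∙
      ifte x>10
        (send warning (val ID) ∙ pvar zero)
        (write cool (val (real off)) ∙ tick∙ (pvar (suc zero)))))

  Ctrl : Proc 0 0
  Ctrl = fix (read sₜ ∙ ifte x>10 Cooling (tick∙ (pvar zero)))

  Eng Êng : CPS
  Eng = engineEnv (- 1#)         ⋈ Ctrl
  Êng = engineEnv (- (tenths 7)) ⋈ Ctrl

  Ctrl-wellFormed : WellFormedProc ｛ cool ｝ ｛ sₜ ｝ Ctrl
  Ctrl-wellFormed = _ , _ , refl , (cooling , _) , _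
    where
    warn    = (λ ()) , _
    stop    = _ , refl , _
    cooling = _ , refl , (_ , ((λ ()) , _) , refl , (warn , stop) , _) , _

  Eng-wellFormed : WellFormed Eng
  Eng-wellFormed = Ctrl-wellFormed

  Êng-wellFormed : WellFormed Êng
  Êng-wellFormed = Ctrl-wellFormed

{-# OPTIONS --safe #-}

-- Eng never sends a warning: cooling starts at a temperature of at most 11.5,
-- since the last reading not above 10 was taken at 10.1 or below and one step
-- adds at most 1.4; each of the five cooling steps removes at least 0.6, so the
-- next reading is at most 8.6.  In Êng a
-- cooling step may remove only 0.3, so the temperature can be 10 after cooling from
-- 11.5, and be read as 10.1.  A bisimulation would match the run leading to
-- this warning by a run of Eng.

module Submission where

open import Algebra.Bundles using (CommutativeRing)
import Algebra.Properties.CommutativeSemigroup as CommutativeSemigroupProperties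
import Algebra.Properties.Ring as RingProperties
open import Data.Bool.Base using (true; false; T)
open import Data.Fin.Base using (zero; suc)
open import Data.Nat.Base as ℕ using (ℕ; zero; suc)
import Data.Nat.Properties as ℕ
open import Data.Product.Base using (∃-syntax; _,_)
open import Data.Sum.Base using (inj₁; inj₂)
open import Level using (0ℓ) renaming (suc to lsuc)
open import Relation.Binary.Bundles using (Poset)
open import Relation.Binary.Construct.Closure.ReflexiveTransitive using (Star; _◅_; _◅◅_) renaming (ε to [])
open import Relation.Binary.Core using (Rel)
open import Relation.Binary.PropositionalEquality.Core
  using (_≡_; _≢_; refl; sym; trans; cong; cong₂; subst)
import Relation.Binary.Reasoning.PartialOrder as PartialOrderReasoning
open import Relation.Binary.Structures using (IsDecTotalOrder)
open import Relation.Nullary.Decidable.Core using (yes; no)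
open import Relation.Nullary.Negation.Core using (¬_; contradiction)
open import Relation.Unary using (Pred; _∈_; ｛_｝)
open import Defs

-- For numerals the implicit argument reduces to the unit type and is filled in automatically, so
-- `≤!` settles closed inequalities.
≤! : ∀ {m n} → {T (m ℕ.≤ᵇ n)} → m ℕ.≤ n
≤! {m} {n} {m≤ᵇn} = ℕ.≤ᵇ⇒≤ m n m≤ᵇn

-- Ordered-field arithmetic on the scale of tenths.

module RealProperties (reals : RealNumbers) where

  open RealNumbers reals

  commutativeRing : CommutativeRing 0ℓ 0ℓ
  commutativeRing = record { isCommutativeRing = isCommutativeRing }

  open CommutativeRing commutativeRing public
    using (+-assoc; +-comm; +-identityˡ; +-identityʳ; -‿inverseˡ; -‿inverseʳ;
           *-identityˡ; zeroˡ; zeroʳ; distribʳ; ring; +-commutativeSemigroup)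
  open CommutativeSemigroupProperties +-commutativeSemigroup using (xy∙z≈xz∙y)
  open RingProperties ring using (-‿distribˡ-*; -‿distribʳ-*; -‿involutive)
  open IsDecTotalOrder isDecTotalOrder public
    using (isPartialOrder; total; antisym)
    renaming (refl to ≤-refl; reflexive to ≤-reflexive; trans to ≤-trans)

  poset : Poset 0ℓ 0ℓ 0ℓ
  poset = record { isPartialOrder = isPartialOrder }

  open PartialOrderReasoning poset

  +-monoʳ-≤ : ∀ z {x y} → x ≤ y → z + x ≤ z + y
  +-monoʳ-≤ z {x} {y} x≤y = begin
    z + x ≡⟨ +-comm z x ⟩
    x + z ≤⟨ +-monoˡ-≤ z x≤y ⟩
    y + z ≡⟨ +-comm y z ⟩
    z + y ∎

  +-mono-≤ : ∀ {w x y z} → w ≤ x → y ≤ z → w + y ≤ x + z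
  +-mono-≤ w≤x y≤z = ≤-trans (+-monoˡ-≤ _ w≤x) (+-monoʳ-≤ _ y≤z)

  [x+y]-y≡x : ∀ x y → x + y + - y ≡ x
  [x+y]-y≡x x y = trans (+-assoc x y (- y))
    (trans (cong (x +_) (-‿inverseʳ y)) (+-identityʳ x))

  [x-y]+y≡x : ∀ x y → x + - y + y ≡ x
  [x-y]+y≡x x y = trans (xy∙z≈xz∙y x (- y) y) ([x+y]-y≡x x y)

  x≤y+z⇒x-z≤y : ∀ {x y z} → x ≤ y + z → x + - z ≤ y
  x≤y+z⇒x-z≤y {x} {y} {z} x≤y+z =
    subst (x + - z ≤_) ([x+y]-y≡x y z) (+-monoˡ-≤ (- z) x≤y+z)

  x-z≤y⇒x≤y+z : ∀ {x y z} → x + - z ≤ y → x ≤ y + z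
  x-z≤y⇒x≤y+z {x} {y} {z} x-z≤y =
    subst (_≤ y + z) ([x-y]+y≡x x z) (+-monoˡ-≤ z x-z≤y)

  x≤0⇒0≤-x : ∀ {x} → x ≤ 0# → 0# ≤ - x
  x≤0⇒0≤-x {x} x≤0 = begin
    0#       ≡⟨ -‿inverseʳ x ⟨
    x + - x  ≤⟨ +-monoˡ-≤ (- x) x≤0 ⟩
    0# + - x ≡⟨ +-identityˡ (- x) ⟩
    - x      ∎

  0≤x⇒-x≤0 : ∀ {x} → 0# ≤ x → - x ≤ 0#
  0≤x⇒-x≤0 {x} 0≤x = begin
    - x      ≡⟨ +-identityˡ (- x) ⟨
    0# + - x ≤⟨ +-monoˡ-≤ (- x) 0≤x ⟩
    x + - x  ≡⟨ -‿inverseʳ x ⟩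
    0#       ∎

  -- Otherwise `- 1#` would be nonnegative, and so would its square, which is `1#`.
  0≤1 : 0# ≤ 1#
  0≤1 with total 0# 1#
  ... | inj₁ 0≤1 = 0≤1
  ... | inj₂ 1≤0 = begin
    0#            ≤⟨ *-nonNegative (x≤0⇒0≤-x 1≤0) (x≤0⇒0≤-x 1≤0) ⟩
    - 1# * - 1#   ≡⟨ -‿distribˡ-* 1# (- 1#) ⟨
    - (1# * - 1#) ≡⟨ cong -_ (*-identityˡ (- 1#)) ⟩
    - (- 1#)      ≡⟨ -‿involutive 1# ⟩
    1#            ∎

  1≰0 : ¬ (1# ≤ 0#)
  1≰0 1≤0 = 0≢1 (antisym 0≤1 1≤0)

  0≤fromℕ : ∀ n → 0# ≤ fromℕ n
  0≤fromℕ zero    = ≤-refl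
  0≤fromℕ (suc n) = begin
    0#           ≡⟨ +-identityˡ 0# ⟨
    0# + 0#      ≤⟨ +-mono-≤ 0≤1 (0≤fromℕ n) ⟩
    1# + fromℕ n ∎

  fromℕ-suc≢0 : ∀ n → fromℕ (suc n) ≢ 0#
  fromℕ-suc≢0 n eq = 1≰0 (begin
    1#           ≡⟨ +-identityʳ 1# ⟨
    1# + 0#      ≤⟨ +-monoʳ-≤ 1# (0≤fromℕ n) ⟩
    1# + fromℕ n ≡⟨ eq ⟩
    0#           ∎)

  fromℕ-+ : ∀ m n → fromℕ (m ℕ.+ n) ≡ fromℕ m + fromℕ n
  fromℕ-+ zero    n = sym (+-identityˡ (fromℕ n))
  fromℕ-+ (suc m) n = trans (cong (1# +_) (fromℕ-+ m n)) (sym (+-assoc 1# _ _))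

  tenths-10 : tenths 10 ≡ 1#
  tenths-10 = ⁻¹-inverseʳ (fromℕ 10) (fromℕ-suc≢0 9)

  -- If the inverse were at most 0, its product with 10 would be too, but that product is 1.
  0≤10⁻¹ : 0# ≤ fromℕ 10 ⁻¹
  0≤10⁻¹ with total 0# (fromℕ 10 ⁻¹)
  ... | inj₁ 0≤u = 0≤u
  ... | inj₂ u≤0 = contradiction 1≤0 1≰0
    where
    1≤0 : 1# ≤ 0#
    1≤0 = begin
      1#                           ≡⟨ -‿involutive 1# ⟨
      - (- 1#)                     ≡⟨ cong (λ x → - (- x)) tenths-10 ⟨
      - (- (fromℕ 10 * fromℕ 10 ⁻¹)) ≡⟨ cong -_ (-‿distribʳ-* _ _) ⟩
      - (fromℕ 10 * - fromℕ 10 ⁻¹) ≤⟨ 0≤x⇒-x≤0 (*-nonNegative (0≤fromℕ 10) (x≤0⇒0≤-x u≤0)) ⟩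
      0#                           ∎

  0≤tenths : ∀ n → 0# ≤ tenths n
  0≤tenths n = *-nonNegative (0≤fromℕ n) 0≤10⁻¹

  tenths-+ : ∀ m n → tenths (m ℕ.+ n) ≡ tenths m + tenths n
  tenths-+ m n = trans (cong (_* fromℕ 10 ⁻¹) (fromℕ-+ m n)) (distribʳ _ _ _)

  -- Puts the thresholds 10 and 30 on the scale of tenths, where bounds compare as natural numbers.
  fromℕ≡tenths : ∀ n → fromℕ n ≡ tenths (n ℕ.* 10)
  fromℕ≡tenths zero    = sym (zeroˡ _)
  fromℕ≡tenths (suc n) = trans (cong₂ _+_ (sym tenths-10) (fromℕ≡tenths n))
    (sym (tenths-+ 10 (n ℕ.* 10)))

  tenths-mono-≤ : ∀ {m n} → m ℕ.≤ n → tenths m ≤ tenths n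
  tenths-mono-≤ {m} {n} m≤n = begin
    tenths m                   ≡⟨ +-identityˡ (tenths m) ⟨
    0# + tenths m              ≤⟨ +-monoˡ-≤ (tenths m) (0≤tenths (n ℕ.∸ m)) ⟩
    tenths (n ℕ.∸ m) + tenths m ≡⟨ tenths-+ (n ℕ.∸ m) m ⟨
    tenths (n ℕ.∸ m ℕ.+ m)     ≡⟨ cong tenths (ℕ.m∸n+n≡m m≤n) ⟩
    tenths n                   ∎

  tenths-1≰0 : ¬ (tenths 1 ≤ 0#)
  tenths-1≰0 le = 0≢1 (begin-equality
    0#                   ≡⟨ zeroʳ (fromℕ 10) ⟨
    fromℕ 10 * 0#        ≡⟨ cong (fromℕ 10 *_) (antisym (0≤tenths 1) le) ⟩
    fromℕ 10 * tenths 1  ≡⟨ cong (fromℕ 10 *_) tenths-1 ⟩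
    tenths 10            ≡⟨ tenths-10 ⟩
    1#                   ∎)
    where
    tenths-1 : tenths 1 ≡ fromℕ 10 ⁻¹
    tenths-1 = trans (cong (_* fromℕ 10 ⁻¹) (+-identityʳ 1#)) (*-identityˡ _)

  tenths-suc≰ : ∀ n → ¬ (tenths (suc n) ≤ tenths n)
  tenths-suc≰ n le = tenths-1≰0 (begin
    tenths 1                       ≡⟨ [x+y]-y≡x (tenths 1) (tenths n) ⟨
    tenths 1 + tenths n + - tenths n ≡⟨ cong (_+ - tenths n) (tenths-+ 1 n) ⟨
    tenths (suc n) + - tenths n    ≤⟨ +-monoˡ-≤ (- tenths n) le ⟩
    tenths n + - tenths n          ≡⟨ -‿inverseʳ (tenths n) ⟩
    0#                             ∎)

  x-y≤x : ∀ x {y} → 0# ≤ y → x + - y ≤ x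
  x-y≤x x {y} 0≤y = begin
    x + - y ≤⟨ +-monoʳ-≤ x (0≤x⇒-x≤0 0≤y) ⟩
    x + 0#  ≡⟨ +-identityʳ x ⟩
    x       ∎

  x≤x+y : ∀ x {y} → 0# ≤ y → x ≤ x + y
  x≤x+y x {y} 0≤y = begin
    x      ≡⟨ +-identityʳ x ⟨
    x + 0# ≤⟨ +-monoʳ-≤ x 0≤y ⟩
    x + y  ∎

  -- Even with the largest uncertainty 0.4, cooling by 1 removes six tenths.
  cooling-≤ : ∀ n {t γ} → t ≤ tenths (6 ℕ.+ n) → γ ≤ tenths 4 → t + - 1# + γ ≤ tenths n
  cooling-≤ n {t} {γ} t≤ γ≤ = begin
    t + - 1# + γ   ≡⟨ xy∙z≈xz∙y t (- 1#) γ ⟩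
    t + γ + - 1#   ≤⟨ x≤y+z⇒x-z≤y t+γ≤ ⟩
    tenths n       ∎
    where
    t+γ≤ : t + γ ≤ tenths n + 1#
    t+γ≤ = begin
      t + γ                         ≤⟨ +-mono-≤ t≤ γ≤ ⟩
      tenths (6 ℕ.+ n) + tenths 4   ≡⟨ tenths-+ (6 ℕ.+ n) 4 ⟨
      tenths (6 ℕ.+ n ℕ.+ 4)        ≡⟨ cong tenths (ℕ.+-comm (6 ℕ.+ n) 4) ⟩
      tenths (10 ℕ.+ n)             ≡⟨ tenths-+ 10 n ⟩
      tenths 10 + tenths n          ≡⟨ +-comm _ _ ⟩
      tenths n + tenths 10          ≡⟨ cong (tenths n +_) tenths-10 ⟩
      tenths n + 1#                 ∎

  heating-≤ : ∀ n {t γ} → t ≤ tenths n → γ ≤ tenths 4 → t + 1# + γ ≤ tenths (n ℕ.+ 10 ℕ.+ 4)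
  heating-≤ n {t} {γ} t≤ γ≤ = begin
    t + 1# + γ                      ≤⟨ +-mono-≤ (+-monoˡ-≤ 1# t≤) γ≤ ⟩
    tenths n + 1# + tenths 4        ≡⟨ cong (λ x → tenths n + x + tenths 4) tenths-10 ⟨
    tenths n + tenths 10 + tenths 4 ≡⟨ cong (_+ tenths 4) (tenths-+ n 10) ⟨
    tenths (n ℕ.+ 10) + tenths 4    ≡⟨ tenths-+ (n ℕ.+ 10) 4 ⟨
    tenths (n ℕ.+ 10 ℕ.+ 4)         ∎

  tenths-heating : ∀ n g → tenths (n ℕ.+ 10 ℕ.+ g) ≡ tenths n + 1# + tenths g
  tenths-heating n g = begin-equality
    tenths (n ℕ.+ 10 ℕ.+ g)         ≡⟨ tenths-+ (n ℕ.+ 10) g ⟩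
    tenths (n ℕ.+ 10) + tenths g    ≡⟨ cong (_+ tenths g) (tenths-+ n 10) ⟩
    tenths n + tenths 10 + tenths g ≡⟨ cong (λ x → tenths n + x + tenths g) tenths-10 ⟩
    tenths n + 1# + tenths g        ∎

  -- The slowest cooling of the modified engine: losing 0.7 and regaining 0.4 is a drop of exactly
  -- three tenths.
  tenths-cooling : ∀ n → tenths n ≡ tenths (3 ℕ.+ n) + - tenths 7 + tenths 4
  tenths-cooling n = begin-equality
    tenths n                                     ≡⟨ [x+y]-y≡x _ _ ⟨
    tenths n + tenths 7 + - tenths 7             ≡⟨ cong (_+ - tenths 7) (tenths-+ n 7) ⟨
    tenths (n ℕ.+ 7) + - tenths 7                ≡⟨ cong (λ k → tenths k + - tenths 7) n+7 ⟩
    tenths (3 ℕ.+ n ℕ.+ 4) + - tenths 7          ≡⟨ cong (_+ - tenths 7) (tenths-+ (3 ℕ.+ n) 4) ⟩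
    tenths (3 ℕ.+ n) + tenths 4 + - tenths 7     ≡⟨ xy∙z≈xz∙y _ _ _ ⟩
    tenths (3 ℕ.+ n) + - tenths 7 + tenths 4     ∎
    where
    n+7 : n ℕ.+ 7 ≡ 3 ℕ.+ n ℕ.+ 4
    -- The two commutations meet because `7 + n` and `4 + (3 + n)` have the same normal form.
    n+7 = trans (ℕ.+-comm n 7) (ℕ.+-comm 4 (3 ℕ.+ n))

-- Environments and residual processes of the engines.

module EngineRuns (reals : RealNumbers) (names : Names)
                  (setting : EngineSetting reals names) where

  open RealNumbers reals
  open RealProperties reals
  open Calculus reals names hiding (subst)
  open Engine reals names setting
  open EngineSetting setting

  -- Transitions change only the state and actuator functions, so every environment reached has this
  -- form.
  engine : ℝ → ℝ^ ｛ temp ｝ → ℝ^ ｛ cool ｝ → Env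
  engine h ξx ξu = record (engineEnv h) { ξx = ξx ; ξu = ξu }

  -- Only the sign is recorded, since `heat` inspects nothing else.
  On Off : Pred (ℝ^ ｛ cool ｝) 0ℓ
  On  ξu = ¬ (0# ≤ ξu cool refl)
  Off ξu = 0# ≤ ξu cool refl

  heat-on : ∀ {h ξu} → On ξu → heat h ξu ≡ h
  heat-on {ξu = ξu} on with 0# ≤? ξu cool refl
  ... | yes off = contradiction off on
  ... | no  _   = refl

  heat-off : ∀ {h ξu} → Off ξu → heat h ξu ≡ 1#
  heat-off {ξu = ξu} off with 0# ≤? ξu cool refl
  ... | yes _  = refl
  ... | no  on = contradiction off on

  lookup-update : ∀ (ξu : ℝ^ ｛ cool ｝) v → (ξu [ cool ↦ v ]) cool refl ≡ v
  lookup-update ξu v with Names._≟_ names cool cool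
  ... | yes _     = refl
  ... | no  c≢c   = contradiction refl c≢c

  on-update : ∀ ξu → On (ξu [ cool ↦ on ])
  on-update ξu = subst (λ v → ¬ (0# ≤ v)) (sym (lookup-update ξu on)) on<0

  off-update : ∀ ξu → Off (ξu [ cool ↦ off ])
  off-update ξu = subst (0# ≤_) (sym (lookup-update ξu off)) off≥0

  ≤10⇒not-above10 : ∀ {v} → v ≤ fromℕ 10 → above10 (real v) ≡ false
  ≤10⇒not-above10 {v} v≤10 with v ≤? fromℕ 10
  ... | yes _    = refl
  ... | no  v≰10 = contradiction v≤10 v≰10

  ≰10⇒above10 : ∀ {v} → ¬ (v ≤ fromℕ 10) → above10 (real v) ≡ true
  ≰10⇒above10 {v} v≰10 with v ≤? fromℕ 10
  ... | yes v≤10 = contradiction v≤10 v≰10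
  ... | no  _    = refl

  not-above10⇒≤10 : ∀ {v} → above10 (real v) ≡ false → v ≤ fromℕ 10
  not-above10⇒≤10 {v} eq with v ≤? fromℕ 10 | eq
  ... | yes v≤10 | _  = v≤10
  ... | no  _    | ()

  -- The loop fix Y of Cooling and its second sensor reading, with Ctrl and the
  -- loop itself substituted for the process variables X and Y.

  Brake Resense : Proc 0 0
  Brake = fix (tick^ 5 (read sₜ ∙
    ifte x>10
      (send warning (val ID) ∙ pvar zero)
      (write cool (val (real off)) ∙ tick∙ (weakenVars 1 (renameProc suc Ctrl)))))
  Resense = read sₜ ∙
    ifte x>10
      (send warning (val ID) ∙ weakenVars 1 Brake)
      (write cool (val (real off)) ∙ tick∙ (weakenVars 1 Ctrl))

  -- What remains after reading `v`. Substitution turns `x>10` into this constant guard by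
  -- computation, so transition targets match definitionally.
  decide reassess : ℝ → Proc 0 0
  decide v = ifte (λ _ → above10 (real v)) (write cool (val (real on)) ∙ Brake) (tick∙ Ctrl)
  reassess v =
    ifte (λ _ → above10 (real v))
      (send warning (val ID) ∙ Brake)
      (write cool (val (real off)) ∙ tick∙ Ctrl)

  -- Some reading is always available, so a state about to read has a τ-transition and cannot let
  -- time pass.
  exact-reading : ∀ ξx ξu → ξx temp refl ∈ readSensor (engine (- 1#) ξx ξu) sₜ
  exact-reading ξx ξu =
    refl , (λ _ _ → ξx temp refl) , (x-y≤x _ (0≤tenths 1) , x≤x+y _ (0≤tenths 1)) , refl

  -- A safety invariant of `Eng`.

  -- With k cooling steps left before the next reading, 8.5 + 0.6 k bounds the
  -- temperature, which gives 11.5 at the start and 8.5 at the reading.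

  data Safe : Pred CPS 0ℓ where
    sensing   : ∀ {ξx ξu} → ξx temp refl ≤ tenths 115 → Off ξu →
                Safe (engine (- 1#) ξx ξu ⋈ Ctrl)
    deciding  : ∀ {ξx ξu v} → ξx temp refl ≤ tenths 115 →
                (v ≤ fromℕ 10 → ξx temp refl ≤ tenths 101) → Off ξu →
                Safe (engine (- 1#) ξx ξu ⋈ decide v)
    resuming  : ∀ {ξx ξu} → ξx temp refl ≤ tenths 101 → Off ξu →
                Safe (engine (- 1#) ξx ξu ⋈ tick∙ Ctrl)
    cooling   : ∀ {ξx ξu} → ξx temp refl ≤ tenths 115 → On ξu →
                Safe (engine (- 1#) ξx ξu ⋈ Brake)
    braking   : ∀ {ξx ξu} k → ξx temp refl ≤ tenths (k ℕ.* 6 ℕ.+ 85) → On ξu →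
                Safe (engine (- 1#) ξx ξu ⋈ tick^ k Resense)
    reassessing : ∀ {ξx ξu v} → ξx temp refl ≤ tenths 85 → v ≤ fromℕ 10 →
                Safe (engine (- 1#) ξx ξu ⋈ reassess v)

  reading-≤10 : ∀ {t v} → t + - ε ≤ v → v ≤ fromℕ 10 → t ≤ tenths 101
  reading-≤10 {t} {v} t-ε≤v v≤10 = ≤-trans (x-z≤y⇒x≤y+z t-ε≤v)
    (≤-trans (+-monoˡ-≤ ε v≤10) (≤-reflexive
      (trans (cong (_+ ε) (fromℕ≡tenths 10)) (sym (tenths-+ 100 1)))))

  cooled-reading : ∀ {t v} → t ≤ tenths 85 → v ≤ t + ε → v ≤ fromℕ 10
  cooled-reading t≤ v≤ = ≤-trans v≤ (≤-trans (+-monoˡ-≤ ε t≤)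
    (≤-trans (≤-reflexive (sym (tenths-+ 85 1)))
      (≤-trans (tenths-mono-≤ {86} {100} ≤!) (≤-reflexive (sym (fromℕ≡tenths 10))))))

  heated : ∀ {ξu s t γ} → s ≤ tenths 101 → Off ξu → γ ≤ δ →
           t ≡ s + heat (- 1#) ξu + γ → t ≤ tenths 115
  heated {ξu} {s} {γ = γ} s≤ off γ≤ eq =
    subst (_≤ tenths 115)
      (sym (trans eq (cong (λ h → s + h + γ) (heat-off {ξu = ξu} off))))
      (heating-≤ 101 s≤ γ≤)

  cooled : ∀ n {ξu s t γ} → s ≤ tenths (6 ℕ.+ n) → On ξu → γ ≤ δ →
           t ≡ s + heat (- 1#) ξu + γ → t ≤ tenths n
  cooled n {ξu} {s} {γ = γ} s≤ on γ≤ eq =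
    subst (_≤ tenths n)
      (sym (trans eq (cong (λ h → s + h + γ) (heat-on {ξu = ξu} on))))
      (cooling-≤ n s≤ γ≤)

  -- Each state offers at most one prefix, so inverting the transition leaves at most one live case
  -- per state; without parallel composition `tau` never applies.
  safe-τ : ∀ {M M′} → Safe M → M —τ→ M′ → Safe M′
  -- One `rec` unfolds `Ctrl`, the other the `fix` inside the prefix abbreviation.
  safe-τ (sensing t≤ off) (sensRead _ (rec (rec read)) (_ , _ , (lo , _) , refl)) =
    deciding t≤ (reading-≤10 lo) off
  safe-τ (sensing _ _) (actWrite _ (rec (rec ())))
  safe-τ (sensing _ _) (tau _ (rec (rec ())))
  safe-τ (deciding _ _ _) (sensRead _ (if-true _ (rec ())) _)
  safe-τ (deciding _ _ _) (sensRead _ (if-false _ ()) _)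
  safe-τ (deciding {ξu = ξu} t≤ _ _) (actWrite _ (if-true _ (rec write))) =
    cooling t≤ (on-update ξu)
  safe-τ (deciding _ _ _) (actWrite _ (if-false _ ()))
  safe-τ (deciding _ _ _) (tau _ (if-true _ (rec ())))
  safe-τ (deciding _ _ _) (tau _ (if-false _ ()))
  safe-τ (resuming _ _) (sensRead _ () _)
  safe-τ (resuming _ _) (actWrite _ ())
  safe-τ (resuming _ _) (tau _ ())
  safe-τ (cooling _ _) (sensRead _ (rec ()) _)
  safe-τ (cooling _ _) (actWrite _ (rec ()))
  safe-τ (cooling _ _) (tau _ (rec ()))
  safe-τ (braking zero t≤ _) (sensRead _ (rec read) (_ , _ , (_ , hi) , refl)) =
    reassessing t≤ (cooled-reading t≤ hi)
  safe-τ (braking zero _ _) (actWrite _ (rec ()))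
  safe-τ (braking zero _ _) (tau _ (rec ()))
  safe-τ (braking (suc k) _ _) (sensRead _ () _)
  safe-τ (braking (suc k) _ _) (actWrite _ ())
  safe-τ (braking (suc k) _ _) (tau _ ())
  safe-τ (reassessing _ _) (sensRead _ (if-true _ (rec ())) _)
  safe-τ (reassessing _ _) (sensRead _ (if-false _ (rec ())) _)
  safe-τ (reassessing _ _) (actWrite _ (if-true _ (rec ())))
  safe-τ (reassessing {ξu = ξu} t≤ _) (actWrite _ (if-false _ (rec write))) =
    resuming (≤-trans t≤ (tenths-mono-≤ {85} {101} ≤!)) (off-update ξu)
  safe-τ (reassessing _ _) (tau _ (if-true _ (rec ())))
  safe-τ (reassessing _ _) (tau _ (if-false _ (rec ())))

  -- Time passes only when no τ is possible, which excludes every state with an enabled read or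
  -- write.
  safe-tick : ∀ {M M′} → Safe M → M —[ tick ]→ M′ → Safe M′
  safe-tick (sensing {ξx} {ξu} _ _) (time i _ ¬τ _) =
    contradiction (_ , sensRead i (rec (rec read)) (exact-reading ξx ξu)) ¬τ
  safe-tick (deciding _ _ _) (time i (if-true above _) ¬τ _) =
    contradiction (_ , actWrite i (if-true above (rec write))) ¬τ
  -- The else branch means a reading of at most 10, which releases the conditional bound 10.1.
  safe-tick (deciding {ξu = ξu} _ t≤ off) (time _ (if-false above delay) _ (_ , (_ , _ , γ≤ , eq) , refl)) =
    sensing (heated {ξu} (t≤ (not-above10⇒≤10 above)) off γ≤ eq) off
  safe-tick (resuming {ξu = ξu} t≤ off) (time _ delay _ (_ , (_ , _ , γ≤ , eq) , refl)) =
    sensing (heated {ξu} t≤ off γ≤ eq) off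
  -- The first of the five ticks leaves four, with bound 4 * 6 + 85 = 109 = 115 - 6.
  safe-tick (cooling {ξu = ξu} t≤ on) (time _ (rec delay) _ (_ , (_ , _ , γ≤ , eq) , refl)) =
    braking 4 (cooled 109 {ξu} t≤ on γ≤ eq) on
  safe-tick (braking {ξx} {ξu} zero _ _) (time i _ ¬τ _) =
    contradiction (_ , sensRead i (rec read) (exact-reading ξx ξu)) ¬τ
  safe-tick (braking {ξu = ξu} (suc k) t≤ on) (time _ delay _ (_ , (_ , _ , γ≤ , eq) , refl)) =
    braking k (cooled (k ℕ.* 6 ℕ.+ 85) {ξu} t≤ on γ≤ eq) on
  safe-tick (reassessing _ v≤10) (time i _ ¬τ _) =
    contradiction (_ , actWrite i (if-false (≤10⇒not-above10 v≤10) (rec write))) ¬τ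

  -- The only output that could be enabled is in `reassess`, behind a guard that the bound on `v`
  -- makes false.
  safe-out : ∀ {M M′ c v} → Safe M → ¬ (M —[ out c v ]→ M′)
  safe-out (sensing _ _)        (out _ (rec (rec ())))
  safe-out (deciding _ _ _)     (out _ (if-true _ (rec ())))
  safe-out (deciding _ _ _)     (out _ (if-false _ ()))
  safe-out (resuming _ _)       (out _ ())
  safe-out (cooling _ _)        (out _ (rec ()))
  safe-out (braking zero _ _)   (out _ (rec ()))
  safe-out (braking (suc _) _ _) (out _ ())
  safe-out (reassessing _ v≤10) (out _ (if-true above _))
    with () ← trans (sym above) (≤10⇒not-above10 v≤10)
  safe-out (reassessing _ _)    (out _ (if-false _ (rec ())))

  safe-⇒ : ∀ {M M′} → Safe M → M ⇒ M′ → Safe M′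
  safe-⇒ s []       = s
  safe-⇒ s (x ◅ xs) = safe-⇒ (safe-τ s x) xs

  -- Matching runs along a bisimulation.

  infix 3 _↝_ _↝*_

  data _↝_ (M N : CPS) : Set₁ where
    act  : M —τ→ N → M ↝ N
    pass : M —[ tick ]→ N → M ↝ N

  _↝*_ : Rel CPS (lsuc 0ℓ)
  _↝*_ = Star _↝_

  -- By induction on the run, `N` answers every step through safe states only, so it can never
  -- answer the final output.
  safe-matching : ∀ {R M N M′ M″ c v} → IsBisimulation R → R M N → Safe N →
                  M ↝* M′ → ¬ (M′ —[ out c v ]→ M″)
  safe-matching B r s [] o with IsBisimulation.transfer B r o
  ... | _ , (_ , _ , N⇒ , o′ , _) , _ = safe-out (safe-⇒ s N⇒) o′
  safe-matching B r s (act x ◅ xs) o with IsBisimulation.transfer B r (τ x)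
  ... | _ , N⇒ , r′ = safe-matching B r′ (safe-⇒ s N⇒) xs o
  safe-matching B r s (pass x ◅ xs) o with IsBisimulation.transfer B r x
  ... | _ , (_ , _ , N⇒ , x′ , ⇒N) , r′ =
    safe-matching B r′ (safe-⇒ (safe-tick (safe-⇒ s N⇒) x′) ⇒N) xs o

  -- A run of `Êng` that ends in a warning.

  state : ℕ → ℝ^ ｛ cool ｝ → Proc 0 0 → CPS
  state n ξu P = engine (- tenths 7) (λ _ _ → tenths n) ξu ⋈ P

  invariant-state : ∀ n ξu → n ℕ.≤ 300 → invariant (engine (- tenths 7) (λ _ _ → tenths n) ξu) ≡ true
  invariant-state n ξu n≤300 with 0# ≤? tenths n | tenths n ≤? fromℕ 30
  ... | yes _   | yes _   = refl
  ... | no  0≰n | _       = contradiction (0≤tenths n) 0≰n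
  ... | yes _   | no n≰30 =
    contradiction (≤-trans (tenths-mono-≤ n≤300) (≤-reflexive (sym (fromℕ≡tenths 30)))) n≰30

  -- The error `ε` is one tenth, so a reading may differ from the temperature by one in either
  -- direction.
  reading : ∀ n m ξu → n ℕ.≤ suc m → m ℕ.≤ suc n →
            tenths m ∈ readSensor (engine (- tenths 7) (λ _ _ → tenths n) ξu) sₜ
  reading n m ξu n≤ m≤ =
    refl , (λ _ _ → tenths m) , (x≤y+z⇒x-z≤y (≤-suc n≤) , ≤-suc m≤) , refl
    where
    ≤-suc : ∀ {i j} → i ℕ.≤ suc j → tenths i ≤ tenths j + ε
    ≤-suc {i} {j} i≤ = ≤-trans (tenths-mono-≤ i≤)
      (≤-reflexive (trans (tenths-+ 1 j) (+-comm ε (tenths j))))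

  -- Stronger than the negative premise of `time`, but independent of the environment, so absurd
  -- patterns establish it.
  Idle : Proc 0 0 → Set
  Idle P = ∀ {l Q} → ¬ (P ⟶⟨ l ⟩ Q)

  idle⇒¬τ : ∀ {E P} → Idle P → ¬ (∃[ N ] (E ⋈ P —τ→ N))
  idle⇒¬τ idle (_ , sensRead _ d _) = idle d
  idle⇒¬τ idle (_ , actWrite _ d)   = idle d
  idle⇒¬τ idle (_ , tau _ d)        = idle d

  -δ≤tenths : ∀ g → - δ ≤ tenths g
  -δ≤tenths g = ≤-trans (0≤x⇒-x≤0 (0≤tenths 4)) (0≤tenths g)

  heating-tick : ∀ {P P′ ξu} n g → n ℕ.≤ 300 → g ℕ.≤ 4 → Off ξu → Idle P → P ⟶tick P′ →
                 state n ξu P ↝ state (n ℕ.+ 10 ℕ.+ g) ξu P′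
  heating-tick {ξu = ξu} n g n≤ g≤ off idle d =
    pass (time (invariant-state n ξu n≤) d (idle⇒¬τ idle)
      (_ , (tenths g , -δ≤tenths g , tenths-mono-≤ g≤ ,
            trans (tenths-heating n g)
              (cong (λ h → tenths n + h + tenths g) (sym (heat-off {ξu = ξu} off)))) , refl))

  cooling-tick : ∀ {P P′ ξu} n → 3 ℕ.+ n ℕ.≤ 300 → On ξu → Idle P → P ⟶tick P′ →
                 state (3 ℕ.+ n) ξu P ↝ state n ξu P′
  cooling-tick {ξu = ξu} n n≤ on idle d =
    pass (time (invariant-state (3 ℕ.+ n) ξu n≤) d (idle⇒¬τ idle)
      (_ , (δ , -δ≤tenths 4 , ≤-refl ,
            trans (tenths-cooling n)
              (cong (λ h → tenths (3 ℕ.+ n) + h + δ) (sym (heat-on {ξu = ξu} on)))) , refl))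

  tenths-≤10 : ∀ {m} → m ℕ.≤ 100 → tenths m ≤ fromℕ 10
  tenths-≤10 m≤ = ≤-trans (tenths-mono-≤ m≤) (≤-reflexive (sym (fromℕ≡tenths 10)))

  tenths-≰10 : ∀ {m} → 101 ℕ.≤ m → ¬ (tenths m ≤ fromℕ 10)
  tenths-≰10 m≥ m≤10 = tenths-suc≰ 100
    (≤-trans (tenths-mono-≤ m≥) (≤-trans m≤10 (≤-reflexive (fromℕ≡tenths 10))))

  -- One read and one tick: `m` is the reading and `g` the uncertainty, both in tenths.
  heating-cycle : ∀ {ξu} n m g → n ℕ.≤ 300 → n ℕ.≤ suc m → m ℕ.≤ suc n → m ℕ.≤ 100 →
                  g ℕ.≤ 4 → Off ξu → state n ξu Ctrl ↝* state (n ℕ.+ 10 ℕ.+ g) ξu Ctrl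
  heating-cycle {ξu} n m g n≤ n≤m m≤n m≤ g≤ off =
    act (sensRead (invariant-state n ξu n≤) (rec (rec read)) (reading n m ξu n≤m m≤n)) ◅
    heating-tick n g n≤ g≤ off idle (if-false below delay) ◅
    []
    where
    below : above10 (real (tenths m)) ≡ false
    below = ≤10⇒not-above10 (tenths-≤10 m≤)
    idle : Idle (decide (tenths m))
    idle (if-true above _) with () ← trans (sym above) below
    idle (if-false _ ())

  ξu-off ξu-on : ℝ^ ｛ cool ｝
  ξu-off = λ _ _ → off
  ξu-on  = ξu-off [ cool ↦ on ]

  -- The reading 10.0 at temperature 10.1 lets the engine heat up once more.

  heating-run : Êng ↝* state 115 ξu-off Ctrl
  heating-run =
    subst (λ t → engine (- tenths 7) (λ _ _ → t) ξu-off ⋈ Ctrl ↝* state 115 ξu-off Ctrl)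
      -- The initial temperature is `0#`, equal to `tenths 0` only propositionally.
      (zeroˡ _) (
      -- Seven rises of 1.3 give 9.1; rises of 1.0 and 1.4 then give 10.1 and 11.5.
      heating-cycle 0 0 3 ≤! ≤! ≤! ≤! ≤! off≥0 ◅◅
      heating-cycle 13 13 3 ≤! ≤! ≤! ≤! ≤! off≥0 ◅◅
      heating-cycle 26 26 3 ≤! ≤! ≤! ≤! ≤! off≥0 ◅◅
      heating-cycle 39 39 3 ≤! ≤! ≤! ≤! ≤! off≥0 ◅◅
      heating-cycle 52 52 3 ≤! ≤! ≤! ≤! ≤! off≥0 ◅◅
      heating-cycle 65 65 3 ≤! ≤! ≤! ≤! ≤! off≥0 ◅◅
      heating-cycle 78 78 3 ≤! ≤! ≤! ≤! ≤! off≥0 ◅◅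
      heating-cycle 91 91 0 ≤! ≤! ≤! ≤! ≤! off≥0 ◅◅
      heating-cycle 101 100 4 ≤! ≤! ≤! ≤! ≤! off≥0)

  cooling-run : state 115 ξu-off Ctrl ↝* state 100 ξu-on (reassess (tenths 101))
  cooling-run =
    act (sensRead (invariant-state 115 ξu-off ≤!) (rec (rec read)) (reading 115 115 ξu-off ≤! ≤!)) ◅
    act (actWrite (invariant-state 115 ξu-off ≤!)
      (if-true (≰10⇒above10 (tenths-≰10 {115} ≤!)) (rec write))) ◅
    cooling-tick 112 ≤! brakes-on (λ { (rec ()) }) (rec delay) ◅
    cooling-tick 109 ≤! brakes-on (λ ()) delay ◅
    cooling-tick 106 ≤! brakes-on (λ ()) delay ◅
    cooling-tick 103 ≤! brakes-on (λ ()) delay ◅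
    cooling-tick 100 ≤! brakes-on (λ ()) delay ◅
    -- The largest sensor error turns the temperature 10.0 into the reading 10.1.
    act (sensRead (invariant-state 100 ξu-on ≤!) (rec read) (reading 100 101 ξu-on ≤! ≤!)) ◅
    []
    where
    brakes-on : On ξu-on
    brakes-on = on-update ξu-off

  warned : state 100 ξu-on (reassess (tenths 101)) —[ out warning ID ]→ state 100 ξu-on Brake
  warned = out (invariant-state 100 ξu-on ≤!)
    (if-true (≰10⇒above10 (tenths-≰10 {101} ≤!)) (rec outp))

proposition13 : (reals : RealNumbers) (names : Names) (setting : EngineSetting reals names) →
    let open Calculus reals names
        open Engine reals names setting
    in ¬ (Eng ≈ Êng)
proposition13 reals names setting (R , B , Eng-R-Êng) =
  -- The pair is reversed so that `Êng` moves and `Eng`, initially safe at temperature 0, has to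
  -- answer.
  safe-matching B (IsBisimulation.symmetric B Eng-R-Êng) (sensing (0≤tenths 115) off≥0)
    (heating-run ◅◅ cooling-run) warned
  where
  open RealProperties reals
  open Calculus reals names
  open EngineSetting setting
  open EngineRuns reals names setting
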